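{- Let $P(x)\subseteq[0,1]^{d_x}$ be a $0$-$1$ polytope. For every polytope $Q(x,y)=\{(x,y)\in\mathbb{R}^{d_x}\times\mathbb{R}^{d_y}\mid Ax+By\le b\}$ such that $P(x)\subseteq \operatorname{proj}_x(Q(x,y))$, there is a translation $T[Q(x,y)]$ of $Q$ to product relaxations (that is, a substitution $T$ such that $T[Q(x,y)]$ is a product relaxation of $P(x)$) such that $$P(x)\subseteq \operatorname{proj}_x(T[Q(x,y)])\subseteq \operatorname{proj}_x(Q(x,y)).$$
   Context: A $0$-$1$ polytope $P(x)\subseteq[0,1]^{d}$ is the convex hull of a set of $0$-$1$ vectors. For a polyhedron $K(x,y)$, $\operatorname{proj}_x(K)=\{x\mid \exists y:\ (x,y)\in K\}$. An extended relaxation of $P(x)$ is a linear system (polyhedron) $K(x,y)$ with $\operatorname{proj}_x(K)\supseteq P(x)$. Product relaxation: Given a $0$-$1$ polytope $P(x)\subseteq[0,1]^{d}$, a product relaxation $D(z)$ of $P(x)$ is an extended relaxation of $P(x)$ in variables $z\in\mathbb{R}^{2^d-1}$, with one variable $z_{\mathcal E}$ for every nonempty subset $\mathcal E\subseteq\{x_1,\dots,x_d\}$, where $z_{\{x_i\}}$ is identified with the original variable $x_i$, and such that for every $x\in P(x)\cap\{0,1\}^d$ the vector $f(x)$ with coordinates $f_{\mathcal E}(x)=\prod_{x_i\in\mathcal E}x_i$ belongs to $D(z)$. The function $f$ is called the product section. The projection $\operatorname{proj}_x$ of a product relaxation is the projection onto the coordinates $z_{\{x_i\}}=x_i$. Substitution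 and translation: A substitution $T$ expresses each $y_i$, $i=1,\dots,d_y$, as an affine function of the product variables, $y=T(z,1)$, where $T$ is a $d_y\times 2^{d_x}$ real matrix, $z\in\mathbb{R}^{2^{d_x}-1}$ and $(z,1)$ is $z$ with the scalar $1$ appended. $T[Q(x,y)]$ is the linear system in the variables $z$ obtained from the system $Ax+By\le b$ by substituting for each $y_i$ the $i$-th such affine expression and for each $x_i$ the variable $z_{\{x_i\}}$. It has the same number of inequalities as the system defining $Q$. If $T[Q(x,y)]$ is a product relaxation of $P(x)$ it is called a translation of $Q$ to product relaxations. -}

module Defs where

open import Level using (Level; _⊔_) renaming (suc to lsuc)
open import Algebra.Apartness.Bundles using (HeytingCommutativeRing; HeytingField)
open import Algebra.Bundles using (CommutativeRing)
open import Algebra.Definitions.RawMonoid using (sum) renaming (_×_ to multiple)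
open import Data.Bool.Base using (Bool; if_then_else_)
open import Data.Fin.Base using (Fin)
open import Data.Fin.Subset using (Subset; Nonempty; inside; outside; ⁅_⁆)
open import Data.Fin.Subset.Properties using (nonempty?; x∈⁅x⁆)
open import Data.List.Base using (List; length; lookup)
open import Data.Nat.Base as ℕ using (ℕ)
open import Data.Product.Base using (_×_; _,_; ∃-syntax; Σ-syntax)
open import Data.Sum.Base using (_⊎_)
open import Data.Vec.Base as Vec using (Vec; []; _∷_)
open import Data.Vec.Functional using (Vector; head; tail)
open import Function.Bundles using (_⇔_)
open import Relation.Binary.Core using (Rel)
open import Relation.Binary.Structures using (IsStrictPartialOrder)
open import Relation.Nullary using (¬_; yes; no)
open import Relation.Unary using (Pred; _∈_; _⊆_; _≐_)

-- The axioms of ℝ: a Cauchy-complete Archimedean ordered field. Classically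
-- such a field is unique up to isomorphism. Stating the order through _<_ and
-- inverses through apartness keeps the axioms constructively satisfiable.
record RealField c ℓ₁ ℓ₂ : Set (lsuc (c ⊔ ℓ₁ ⊔ ℓ₂)) where
  field
    heytingField : HeytingField c ℓ₁ ℓ₂

  open HeytingField heytingField public
  open HeytingCommutativeRing heytingCommutativeRing public using (commutativeRing)
  open CommutativeRing commutativeRing public using (+-rawMonoid)

  infix 4 _<_ _≤_
  field
    _<_                    : Rel Carrier ℓ₂
    <-isStrictPartialOrder : IsStrictPartialOrder _≈_ _<_
    #⇔<⊎>                  : ∀ {x y} → x # y ⇔ (x < y ⊎ y < x)
    0<1                    : 0# < 1#
    +-monoˡ-<              : ∀ {x y} z → x < y → x + z < y + z
    *-pos                  : ∀ {x y} → 0# < x → 0# < y → 0# < x * y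

  -- This bounds |s m - s n|, since m and n may be exchanged.
  Cauchy : (ℕ → Carrier) → Set (c ⊔ ℓ₂)
  Cauchy s = ∀ ε → 0# < ε → ∃[ N ] (∀ m n → N ℕ.≤ m → N ℕ.≤ n → s m - s n < ε)

  _ConvergesTo_ : (ℕ → Carrier) → Carrier → Set (c ⊔ ℓ₂)
  s ConvergesTo l =
    ∀ ε → 0# < ε → ∃[ N ] (∀ n → N ℕ.≤ n → (s n - l < ε) × (l - s n < ε))

  field
    archimedean : ∀ x → ∃[ n ] x < multiple +-rawMonoid n 1#
    complete    : ∀ s → Cauchy s → ∃[ l ] s ConvergesTo l

  _≤_ : Rel Carrier ℓ₂
  x ≤ y = ¬ (y < x)

-- The proof of nonemptiness is irrelevant, so that each nonempty subset of
-- {x₁,…,x_d} is the index of exactly one product variable.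
record NonemptySubset (d : ℕ) : Set where
  constructor ⟨_∣_⟩
  field
    subset    : Subset d
    .nonempty : Nonempty subset

module ZeroOnePolytopes {c ℓ₁ ℓ₂} (𝓡 : RealField c ℓ₁ ℓ₂) where

  open RealField 𝓡 public

  private
    variable
      d dx dy m : ℕ
      p q : Level

  ℝ : Set c
  ℝ = Carrier

  ∑ : Vector ℝ m → ℝ
  ∑ = sum +-rawMonoid

  infix 7 _∙_
  _∙_ : Vector ℝ m → Vector ℝ m → ℝ
  u ∙ v = ∑ λ i → u i * v i

  fromBool : Bool → ℝ
  fromBool a = if a then 1# else 0#

  ZeroOne : Pred (Vector ℝ d) ℓ₁
  ZeroOne x = ∀ i → x i ≈ 0# ⊎ x i ≈ 1#

  -- A list enumerates the set, as every set of 0-1 vectors in ℝ^d is finite;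
  -- repetitions do not change the hull.
  ConvexHull : List (Vec Bool d) → Pred (Vector ℝ d) (c ⊔ ℓ₁ ⊔ ℓ₂)
  ConvexHull S x =
    Σ[ w ∈ Vector ℝ (length S) ]
      (∀ k → 0# ≤ w k) ×
      ∑ w ≈ 1# ×
      (∀ i → x i ≈ ∑ λ k → w k * fromBool (Vec.lookup (lookup S k) i))

  IsZeroOnePolytope : Pred (Vector ℝ d) p → Set (c ⊔ ℓ₁ ⊔ ℓ₂ ⊔ p)
  IsZeroOnePolytope P = ∃[ S ] P ≐ ConvexHull S

  -- The system A x + B y ≤ b of m inequalities.
  record LinearSystem (m dx dy : ℕ) : Set c where
    field
      A : Fin m → Vector ℝ dx
      B : Fin m → Vector ℝ dy
      b : Vector ℝ m

  ⟦_⟧ : LinearSystem m dx dy → Pred (Vector ℝ dx × Vector ℝ dy) ℓ₂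
  ⟦ Q ⟧ (x , y) = ∀ j → A j ∙ x + B j ∙ y ≤ b j
    where open LinearSystem Q

  Bounded : Pred (Vector ℝ dx × Vector ℝ dy) q → Set (c ⊔ ℓ₂ ⊔ q)
  Bounded K = ∃[ M ] (∀ x y → (x , y) ∈ K →
    (∀ i → - M ≤ x i × x i ≤ M) × (∀ k → - M ≤ y k × y k ≤ M))

  proj : Pred (Vector ℝ dx × Vector ℝ dy) q → Pred (Vector ℝ dx) (c ⊔ q)
  proj K x = ∃[ y ] (x , y) ∈ K

  ProductVector : ℕ → Set c
  ProductVector d = NonemptySubset d → ℝ

  originals : ProductVector d → Vector ℝ d
  originals z i = z ⟨ ⁅ i ⁆ ∣ (i , x∈⁅x⁆ i) ⟩

  projₓ : Pred (ProductVector d) q → Pred (Vector ℝ d) (c ⊔ ℓ₁ ⊔ q)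
  projₓ D x = ∃[ z ] z ∈ D × (∀ i → originals z i ≈ x i)

  ∏[_] : Subset d → Vector ℝ d → ℝ
  ∏[ []          ] x = 1#
  ∏[ inside  ∷ E ] x = head x * ∏[ E ] (tail x)
  ∏[ outside ∷ E ] x = ∏[ E ] (tail x)

  productSection : Vector ℝ d → ProductVector d
  productSection x ⟨ E ∣ _ ⟩ = ∏[ E ] x

  -- (z,1): the coordinate indexed by the empty set holds the appended 1, so
  -- that the 2^d coordinates are indexed by all subsets.
  append1 : ProductVector d → (Subset d → ℝ)
  append1 z E with nonempty? E
  ... | yes E≢∅ = z ⟨ E ∣ E≢∅ ⟩
  ... | no  _   = 1#

  ΣSubsets : (Subset d → ℝ) → ℝ
  ΣSubsets {d = ℕ.zero}  g = g []
  ΣSubsets {d = ℕ.suc d} g =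
    ΣSubsets (λ E → g (outside ∷ E)) + ΣSubsets (λ E → g (inside ∷ E))

  -- An m × 2^d matrix; its column at the empty set holds the constant terms
  -- of the affine functions given by its rows.
  AffineMap : ℕ → ℕ → Set c
  AffineMap m d = Fin m → Subset d → ℝ

  apply : AffineMap m d → ProductVector d → Vector ℝ m
  apply T z k = ΣSubsets (λ E → T k E * append1 z E)

  -- Solution set of finitely many affine inequalities in z.
  IsPolyhedron : Pred (ProductVector d) q → Set (c ⊔ ℓ₂ ⊔ q)
  IsPolyhedron {d = d} D =
    ∃[ m ] Σ[ C ∈ AffineMap m d ] D ≐ (λ z → ∀ j → apply C z j ≤ 0#)

  record IsProductRelaxation (P : Pred (Vector ℝ d) p) (D : Pred (ProductVector d) q)
         : Set (c ⊔ ℓ₁ ⊔ ℓ₂ ⊔ p ⊔ q) where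
    field
      isPolyhedron    : IsPolyhedron D
      isRelaxation    : P ⊆ projₓ D
      containsSection : ∀ x → x ∈ P → ZeroOne x → productSection x ∈ D

  -- T[Q], with y_k replaced by (T (z,1))_k and x_i by z_{{x_i}}.
  _[_] : AffineMap dy dx → LinearSystem m dx dy → Pred (ProductVector dx) ℓ₂
  (T [ Q ]) z = ∀ j → A j ∙ originals z + B j ∙ apply T z ≤ b j
    where open LinearSystem Q

  IsTranslation : Pred (Vector ℝ dx) p → LinearSystem m dx dy →
                  AffineMap dy dx → Set (c ⊔ ℓ₁ ⊔ ℓ₂ ⊔ p)
  IsTranslation P Q T = IsProductRelaxation P (T [ Q ])

{-# OPTIONS --safe #-}
-- T interpolates: choose y_v with (v , y_v) ∈ Q for every 0-1 vector v ∈ P, and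
-- let T be the multilinear polynomial map with T(f(v)) = y_v, found by Möbius
-- inversion over the subset lattice. Then f(v) ∈ T[Q] for all these v, and as
-- T[Q] is a polyhedron, it contains Σ w_v f(v) whenever x = Σ w_v v is a convex
-- combination. Conversely (x , T(z,1)) ∈ Q whenever z ∈ T[Q] lies over x.
module Submission where

open import Defs
import Algebra.Apartness.Properties.HeytingCommutativeRing as HeytingProperties
open import Algebra.Bundles using (CommutativeMonoid; CommutativeRing)
import Algebra.Properties.CommutativeSemigroup as CommutativeSemigroupProperties
import Algebra.Properties.Ring as RingProperties
import Algebra.Properties.Semiring.Sum as SumProperties
open import Data.Bool.Base using (Bool; true; false; not)
import Data.Bool.Properties as Bool
open import Data.Fin.Base using (Fin; zero; suc)
open import Data.Fin.Subset using (Subset; inside; outside; ⁅_⁆; ⊥)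
open import Data.Fin.Subset.Properties using (nonempty?; x∈⁅x⁆; Empty-unique; ∉⊥)
open import Data.List.Base using (List; length; lookup; []; _∷_)
import Data.List.Membership.DecPropositional as DecMembership
open import Data.List.Membership.Propositional using () renaming (_∈_ to _∈ˡ_)
open import Data.List.Membership.Propositional.Properties using (∈-lookup)
open import Data.List.Relation.Unary.Any using (here; there)
open import Data.Nat.Base using (ℕ; zero; suc)
open import Data.Product.Base using (_×_; _,_; proj₁; proj₂; Σ-syntax; ∃-syntax)
open import Data.Sum.Base using (inj₁; inj₂)
open import Data.Vec.Base as Vec using (Vec; []; _∷_)
import Data.Vec.Properties as Vec
import Data.Vec.Functional as Vector
open import Data.Vec.Functional using (Vector)
open import Function.Base using (_∘_)
open import Function.Bundles using (Equivalence)
open import Level using (Level; _⊔_)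
import Relation.Binary.PropositionalEquality.Core as ≡
open import Relation.Binary.PropositionalEquality.Core using (_≡_)
import Relation.Binary.Reasoning.Setoid as SetoidReasoning
open import Relation.Binary.Structures using (IsStrictPartialOrder)
open import Relation.Nullary using (¬_; Dec; yes; no; contradiction)
open import Relation.Nullary.Decidable using (decidable-stable)
open import Relation.Unary using (Pred; _∈_; _⊆_)

module _ {c ℓ₁ ℓ₂} (𝓡 : RealField c ℓ₁ ℓ₂) where

  open ZeroOnePolytopes 𝓡 hiding (zero)
  open CommutativeRing commutativeRing using (ring; semiring; +-commutativeMonoid; *-commutativeMonoid)
  open CommutativeSemigroupProperties (CommutativeMonoid.commutativeSemigroup +-commutativeMonoid)
    using (interchange)
  open CommutativeSemigroupProperties (CommutativeMonoid.commutativeSemigroup *-commutativeMonoid)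
    using (x∙yz≈y∙xz)
  open RingProperties ring
  open HeytingProperties heytingCommutativeRing
    using (invertibleˡ⇒#; #-congʳ; x-0≈x)
  open SumProperties semiring
    using (sum-cong-≋; ∑-distrib-+; *-distribˡ-sum; sum-replicate-zero)
  open IsStrictPartialOrder <-isStrictPartialOrder
    using (<-respˡ-≈; <-respʳ-≈; irrefl; asym)
  open SetoidReasoning setoid

  private
    variable
      d dx dy m n : ℕ
      q : Level
      x y z t w : ℝ

  _∈?_ : (v : Vec Bool d) (S : List (Vec Bool d)) → Dec (v ∈ˡ S)
  _∈?_ = DecMembership._∈?_ (Vec.≡-dec Bool._≟_)

  bits : Vec Bool d → Vector ℝ d
  bits v i = fromBool (Vec.lookup v i)

  -- Order

  <⇒# : x < y → x # y
  <⇒# = Equivalence.from #⇔<⊎> ∘ inj₁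

  ≤-refl : x ≤ x
  ≤-refl = irrefl refl

  ≤-respʳ-≈ : x ≈ y → z ≤ x → z ≤ y
  ≤-respʳ-≈ x≈y z≤x y<z = z≤x (<-respˡ-≈ (sym x≈y) y<z)

  ≤-respˡ-≈ : x ≈ y → x ≤ z → y ≤ z
  ≤-respˡ-≈ x≈y x≤z z<y = x≤z (<-respʳ-≈ (sym x≈y) z<y)

  ≤-reflexive : x ≈ y → x ≤ y
  ≤-reflexive x≈y = ≤-respʳ-≈ x≈y ≤-refl

  -- Since `x ≤ y` is the negation of `y < x`, transitivity does not come directly from that of `<`.
  -- A supposed `z < x` is split by cotransitivity of apartness at `y`, and each of the four
  -- resulting orderings contradicts a hypothesis.
  ≤-trans : x ≤ y → y ≤ z → x ≤ z
  ≤-trans {y = y} x≤y y≤z z<x with #-cotrans (<⇒# z<x) y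
  ... | inj₁ z#y with Equivalence.to #⇔<⊎> z#y
  ...   | inj₁ z<y = y≤z z<y
  ...   | inj₂ y<z = x≤y (IsStrictPartialOrder.trans <-isStrictPartialOrder y<z z<x)
  ≤-trans {y = y} x≤y y≤z z<x | inj₂ y#x with Equivalence.to #⇔<⊎> y#x
  ...   | inj₁ y<x = x≤y y<x
  ...   | inj₂ x<y = y≤z (IsStrictPartialOrder.trans <-isStrictPartialOrder z<x x<y)

  +-monoˡ-≤ : ∀ z → x ≤ y → x + z ≤ y + z
  +-monoˡ-≤ {x} {y} z x≤y y+z<x+z =
    x≤y (<-respˡ-≈ (//-rightDividesʳ z y) (<-respʳ-≈ (//-rightDividesʳ z x) (+-monoˡ-< (- z) y+z<x+z)))

  +-monoʳ-≤ : ∀ z → x ≤ y → z + x ≤ z + y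
  +-monoʳ-≤ z x≤y =
    ≤-respˡ-≈ (+-comm _ z) (≤-respʳ-≈ (+-comm _ z) (+-monoˡ-≤ z x≤y))

  x≤y⇒x-y≤0 : x ≤ y → x - y ≤ 0#
  x≤y⇒x-y≤0 {y = y} x≤y = ≤-respʳ-≈ (-‿inverseʳ y) (+-monoˡ-≤ (- y) x≤y)

  x-y≤0⇒x≤y : x - y ≤ 0# → x ≤ y
  x-y≤0⇒x≤y {x} {y} x-y≤0 =
    ≤-respˡ-≈ (//-rightDividesˡ y x) (≤-respʳ-≈ (+-identityˡ y) (+-monoˡ-≤ y x-y≤0))

  -- Elements apart from zero are the invertible ones, and if `i` inverts `x * y`, then `i * y`
  -- inverts `x`.
  x*y#0⇒x#0 : ∀ x y → x * y # 0# → x # 0#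
  x*y#0⇒x#0 x y xy#0 with #⇒invertible xy#0
  ... | i , i*xy≈1 , _ = invertibleˡ⇒# (i * y , (begin
    i * y * (x - 0#)   ≈⟨ *-congˡ (x-0≈x x) ⟩
    i * y * x          ≈⟨ *-assoc i y x ⟩
    i * (y * x)        ≈⟨ *-congˡ (*-comm y x) ⟩
    i * (x * y)        ≈⟨ *-congˡ (x-0≈x (x * y)) ⟨
    i * (x * y - 0#)   ≈⟨ i*xy≈1 ⟩
    1#                 ∎))

  -- The signs of `w` and `t` cannot be decided outright. But `0# < w * t` makes both factors apart
  -- from zero, so the weak signs become strict and `*-pos` applies to `w` and `- t`.
  nonneg*nonpos : 0# ≤ w → t ≤ 0# → w * t ≤ 0#
  nonneg*nonpos {w} {t} 0≤w t≤0 0<wt = asym 0<wt wt<0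
    where
    wt#0 : w * t # 0#
    wt#0 = #-sym (<⇒# 0<wt)

    0<w : 0# < w
    0<w with Equivalence.to #⇔<⊎> (x*y#0⇒x#0 w t wt#0)
    ... | inj₁ w<0 = contradiction w<0 0≤w
    ... | inj₂ 0<w = 0<w

    t<0 : t < 0#
    t<0 with Equivalence.to #⇔<⊎> (x*y#0⇒x#0 t w (#-congʳ (*-comm w t) wt#0))
    ... | inj₁ t<0 = t<0
    ... | inj₂ 0<t = contradiction 0<t t≤0

    0<-t : 0# < - t
    0<-t = <-respˡ-≈ (-‿inverseʳ t) (<-respʳ-≈ (+-identityˡ (- t)) (+-monoˡ-< (- t) t<0))

    wt<0 : w * t < 0#
    wt<0 = <-respˡ-≈ (+-identityˡ (w * t))
      (<-respʳ-≈ (trans (+-congʳ (sym (-‿distribʳ-* w t))) (-‿inverseˡ (w * t)))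
        (+-monoˡ-< (w * t) (*-pos 0<w 0<-t)))

  -- Finite sums and the order

  ∑-mono-≤ : {u v : Vector ℝ n} → (∀ k → u k ≤ v k) → ∑ u ≤ ∑ v
  ∑-mono-≤ {n = zero}  u≤v = ≤-refl
  ∑-mono-≤ {n = suc n} {u} {v} u≤v =
    ≤-trans (+-monoˡ-≤ _ (u≤v zero)) (+-monoʳ-≤ (v zero) (∑-mono-≤ (u≤v ∘ suc)))

  ∑-nonneg : {u : Vector ℝ n} → (∀ k → 0# ≤ u k) → 0# ≤ ∑ u
  ∑-nonneg {n = n} 0≤u = ≤-respˡ-≈ (sum-replicate-zero n) (∑-mono-≤ 0≤u)

  ∑-nonpos : {u : Vector ℝ n} → (∀ k → u k ≤ 0#) → ∑ u ≤ 0#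
  ∑-nonpos {n = n} u≤0 = ≤-respʳ-≈ (sum-replicate-zero n) (∑-mono-≤ u≤0)

  term≤∑ : {u : Vector ℝ n} → (∀ k → 0# ≤ u k) → ∀ k → u k ≤ ∑ u
  term≤∑ {u = u} 0≤u zero    =
    ≤-respˡ-≈ (+-identityʳ (u zero)) (+-monoʳ-≤ (u zero) (∑-nonneg (0≤u ∘ suc)))
  term≤∑ {u = u} 0≤u (suc k) = ≤-trans (term≤∑ (0≤u ∘ suc) k)
    (≤-respˡ-≈ (+-identityˡ _) (+-monoˡ-≤ _ (0≤u zero)))

  ∙-congˡ : (a : Vector ℝ n) {u v : Vector ℝ n} → (∀ i → u i ≈ v i) → a ∙ u ≈ a ∙ v
  ∙-congˡ a u≈v = sum-cong-≋ (λ i → *-congˡ (u≈v i))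

  -- 0-1 polytopes

  ConvexHull-cong : (S : List (Vec Bool d)) {x y : Vector ℝ d} →
                    (∀ i → x i ≈ y i) → ConvexHull S x → ConvexHull S y
  ConvexHull-cong S x≈y (w , 0≤w , ∑w≈1 , x≈∑) =
    w , 0≤w , ∑w≈1 , λ i → trans (sym (x≈y i)) (x≈∑ i)

  -- All weight is put on the one position of `S` to which the membership proof points.
  vertex∈hull : {S : List (Vec Bool d)} {v : Vec Bool d} → v ∈ˡ S → bits v ∈ ConvexHull S
  vertex∈hull {S = v ∷ S} (here ≡.refl) =
    1# Vector.∷ (λ _ → 0#) ,
    (λ { zero → asym 0<1 ; (suc k) → ≤-refl }) ,
    trans (+-congˡ (sum-replicate-zero (length S))) (+-identityʳ 1#) ,
    λ i → sym (begin
      1# * bits v i + ∑ (λ k → 0# * bits (lookup S k) i)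
        ≈⟨ +-cong (*-identityˡ _) (sum-cong-≋ (λ k → zeroˡ (bits (lookup S k) i))) ⟩
      bits v i + ∑ {length S} (λ _ → 0#)  ≈⟨ +-congˡ (sum-replicate-zero (length S)) ⟩
      bits v i + 0#                       ≈⟨ +-identityʳ _ ⟩
      bits v i                            ∎)
  vertex∈hull {S = s ∷ S} (there v∈S) with vertex∈hull v∈S
  ... | w , 0≤w , ∑w≈1 , v≈∑ =
    0# Vector.∷ w ,
    (λ { zero → ≤-refl ; (suc k) → 0≤w k }) ,
    trans (+-identityˡ _) ∑w≈1 ,
    λ i → trans (v≈∑ i) (sym (trans (+-congʳ (zeroˡ _)) (+-identityˡ _)))

  nonneg*bit : ∀ b → 0# ≤ w → 0# ≤ w * fromBool b
  nonneg*bit false 0≤w = ≤-reflexive (sym (zeroʳ _))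
  nonneg*bit true  0≤w = ≤-respʳ-≈ (sym (*-identityʳ _)) 0≤w

  w*bit+w*not≈w : ∀ w b → w * fromBool b + w * fromBool (not b) ≈ w
  w*bit+w*not≈w w false = trans (+-cong (zeroʳ w) (*-identityʳ w)) (+-identityˡ w)
  w*bit+w*not≈w w true  = trans (+-cong (*-identityʳ w) (zeroʳ w)) (+-identityʳ w)

  module _ {w : Vector ℝ n} (0≤w : ∀ k → 0# ≤ w k) (∑w≈1 : ∑ w ≈ 1#) where

    -- The values 0 and 1 are extreme in the unit interval, so a weighted average attains one of
    -- them only if every term of positive weight does.
    positive⇒bit≡ : (a : Fin n → Bool) (b : Bool) →
                    fromBool b ≈ ∑ (λ k → w k * fromBool (a k)) →
                    ∀ k → 0# < w k → a k ≡ b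
    -- The order only refutes that the bits differ; equality of booleans is decidable, hence stable
    -- under double negation.
    positive⇒bit≡ a b b≈∑ k 0<wk = decidable-stable (a k Bool.≟ b) (λ ak≢b → excess b b≈∑ ak≢b)
      where
      excess : ∀ b → fromBool b ≈ ∑ (λ k → w k * fromBool (a k)) → ¬ ¬ a k ≡ b
      excess false 0≈∑ ak≢0 = ≤-respʳ-≈ (sym 0≈∑)
        (≤-respˡ-≈ (trans (*-congˡ (reflexive (≡.cong fromBool (Bool.¬-not ak≢0)))) (*-identityʳ _))
          (term≤∑ (λ j → nonneg*bit (a j) (0≤w j)) k)) 0<wk
      -- Complementing the bits reduces this to the previous case: the complementary sum is the
      -- total weight 1 minus 1.
      excess true  1≈∑ ak≢1 = ≤-respʳ-≈ ∑not≈0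
        (≤-respˡ-≈ (trans (*-congˡ (reflexive (≡.cong (fromBool ∘ not) (Bool.¬-not ak≢1)))) (*-identityʳ _))
          (term≤∑ (λ j → nonneg*bit (not (a j)) (0≤w j)) k)) 0<wk
        where
        ∑not≈0 : ∑ (λ j → w j * fromBool (not (a j))) ≈ 0#
        ∑not≈0 = +-cancelˡ 1# _ _ (begin
          1# + ∑ (λ j → w j * fromBool (not (a j)))  ≈⟨ +-congʳ 1≈∑ ⟩
          ∑ (λ j → w j * fromBool (a j)) + ∑ (λ j → w j * fromBool (not (a j)))
            ≈⟨ ∑-distrib-+ (λ j → w j * fromBool (a j)) _ ⟨
          ∑ (λ j → w j * fromBool (a j) + w j * fromBool (not (a j)))
            ≈⟨ sum-cong-≋ (λ j → w*bit+w*not≈w (w j) (a j)) ⟩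
          ∑ w      ≈⟨ ∑w≈1 ⟩
          1#       ≈⟨ +-identityʳ 1# ⟨
          1# + 0#  ∎)

  -- Vertices of the cube are extreme points: an entry of `S` with positive weight agrees with `v`
  -- in every bit. If `v` were not listed, no weight could be positive, and the total would be at
  -- most 0 instead of 1.
  hull∩bits⇒∈ : (S : List (Vec Bool d)) (v : Vec Bool d) → bits v ∈ ConvexHull S → v ∈ˡ S
  hull∩bits⇒∈ S v (w , 0≤w , ∑w≈1 , v≈∑) = decidable-stable (v ∈? S) λ v∉S →
    ∑-nonpos (λ k 0<wk → v∉S (≡.subst (_∈ˡ S) (lookup≡v k 0<wk) (∈-lookup k)))
      (<-respʳ-≈ (sym ∑w≈1) 0<1)
    where
    lookup≡v : ∀ k → 0# < w k → lookup S k ≡ v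
    lookup≡v k 0<wk = ≡.trans (≡.sym (Vec.tabulate∘lookup (lookup S k)))
      (≡.trans
        (Vec.tabulate-cong λ i →
          positive⇒bit≡ 0≤w ∑w≈1 (λ j → Vec.lookup (lookup S j) i) _ (v≈∑ i) k 0<wk)
        (Vec.tabulate∘lookup v))

  ZeroOne⇒bits : {x : Vector ℝ d} → ZeroOne x → ∃[ v ] (∀ i → x i ≈ bits v i)
  ZeroOne⇒bits {d = d} {x} zo = Vec.tabulate bit , λ i →
    trans (x≈bit i) (reflexive (≡.cong fromBool (≡.sym (Vec.lookup∘tabulate bit i))))
    where
    bit : Fin d → Bool
    bit i with zo i
    ... | inj₁ _ = false
    ... | inj₂ _ = true

    x≈bit : ∀ i → x i ≈ fromBool (bit i)
    x≈bit i with zo i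
    ... | inj₁ x≈0 = x≈0
    ... | inj₂ x≈1 = x≈1

  -- Affine functions of the product variables

  ΣSubsets-cong : {f g : Subset d → ℝ} → (∀ E → f E ≈ g E) → ΣSubsets f ≈ ΣSubsets g
  ΣSubsets-cong {d = zero}  f≈g = f≈g []
  ΣSubsets-cong {d = suc d} f≈g =
    +-cong (ΣSubsets-cong (f≈g ∘ (outside ∷_))) (ΣSubsets-cong (f≈g ∘ (inside ∷_)))

  ΣSubsets-+ : (f g : Subset d → ℝ) → ΣSubsets (λ E → f E + g E) ≈ ΣSubsets f + ΣSubsets g
  ΣSubsets-+ {d = zero}  f g = refl
  ΣSubsets-+ {d = suc d} f g = trans
    (+-cong (ΣSubsets-+ (f ∘ (outside ∷_)) _) (ΣSubsets-+ (f ∘ (inside ∷_)) _))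
    (interchange _ _ _ _)

  *-distribˡ-ΣSubsets : ∀ a (f : Subset d → ℝ) → a * ΣSubsets f ≈ ΣSubsets (λ E → a * f E)
  *-distribˡ-ΣSubsets {d = zero}  a f = refl
  *-distribˡ-ΣSubsets {d = suc d} a f = trans (distribˡ a _ _)
    (+-cong (*-distribˡ-ΣSubsets a (f ∘ (outside ∷_))) (*-distribˡ-ΣSubsets a (f ∘ (inside ∷_))))

  ΣSubsets-zero : ΣSubsets {d} (λ _ → 0#) ≈ 0#
  ΣSubsets-zero {d = zero}  = refl
  ΣSubsets-zero {d = suc d} =
    trans (+-cong (ΣSubsets-zero {d}) (ΣSubsets-zero {d})) (+-identityˡ 0#)

  ΣSubsets-∑ : (f : Fin n → Subset d → ℝ) →
               ΣSubsets (λ E → ∑ (λ k → f k E)) ≈ ∑ (λ k → ΣSubsets (f k))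
  ΣSubsets-∑ {n = zero}  {d} f = ΣSubsets-zero {d}
  ΣSubsets-∑ {n = suc n} f =
    trans (ΣSubsets-+ (f zero) _) (+-congˡ (ΣSubsets-∑ (f ∘ suc)))

  -- The Kronecker delta on subsets, serving as the coefficient row that selects one coordinate of
  -- `(z,1)`.
  indicator : Subset d → Subset d → ℝ
  indicator []            []            = 1#
  indicator (outside ∷ F) (outside ∷ E) = indicator F E
  indicator (outside ∷ F) (inside  ∷ E) = 0#
  indicator (inside  ∷ F) (outside ∷ E) = 0#
  indicator (inside  ∷ F) (inside  ∷ E) = indicator F E

  ΣSubsets-indicator : (F : Subset d) (g : Subset d → ℝ) →
                       ΣSubsets (λ E → indicator F E * g E) ≈ g F
  ΣSubsets-indicator []            g = *-identityˡ (g [])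
  ΣSubsets-indicator (outside ∷ F) g = trans
    (+-cong (ΣSubsets-indicator F (g ∘ (outside ∷_)))
            (trans (ΣSubsets-cong (λ E → zeroˡ (g (inside ∷ E)))) (ΣSubsets-zero {Vec.length F})))
    (+-identityʳ _)
  ΣSubsets-indicator (inside ∷ F)  g = trans
    (+-cong (trans (ΣSubsets-cong (λ E → zeroˡ (g (outside ∷ E)))) (ΣSubsets-zero {Vec.length F}))
            (ΣSubsets-indicator F (g ∘ (inside ∷_))))
    (+-identityˡ _)

  -- The witness has the shape of a row of an `AffineMap`, its entry at the empty set being the
  -- constant term. Closure under sums and multiples then yields the matrix demanded by
  -- `IsPolyhedron`.
  IsAffine : (ProductVector d → ℝ) → Set (c ⊔ ℓ₁)
  IsAffine {d} F =
    Σ[ C ∈ (Subset d → ℝ) ] (∀ z → F z ≈ ΣSubsets (λ E → C E * append1 z E))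

  affine-coordinate : (E : Subset d) → IsAffine (λ z → append1 z E)
  affine-coordinate E = indicator E , λ z → sym (ΣSubsets-indicator E (append1 z))

  affine-+ : {F G : ProductVector d → ℝ} → IsAffine F → IsAffine G → IsAffine (λ z → F z + G z)
  affine-+ {F = F} {G} (C , F≈) (D , G≈) = (λ E → C E + D E) , λ z → begin
    F z + G z                                          ≈⟨ +-cong (F≈ z) (G≈ z) ⟩
    ΣSubsets (λ E → C E * append1 z E) + ΣSubsets (λ E → D E * append1 z E)
      ≈⟨ ΣSubsets-+ (λ E → C E * append1 z E) _ ⟨
    ΣSubsets (λ E → C E * append1 z E + D E * append1 z E)
      ≈⟨ ΣSubsets-cong (λ E → distribʳ (append1 z E) (C E) (D E)) ⟨
    ΣSubsets (λ E → (C E + D E) * append1 z E)         ∎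

  affine-* : ∀ a {F : ProductVector d → ℝ} → IsAffine F → IsAffine (λ z → a * F z)
  affine-* a {F} (C , F≈) = (λ E → a * C E) , λ z → begin
    a * F z                                     ≈⟨ *-congˡ (F≈ z) ⟩
    a * ΣSubsets (λ E → C E * append1 z E)      ≈⟨ *-distribˡ-ΣSubsets a (λ E → C E * append1 z E) ⟩
    ΣSubsets (λ E → a * (C E * append1 z E))
      ≈⟨ ΣSubsets-cong (λ E → *-assoc a (C E) (append1 z E)) ⟨
    ΣSubsets (λ E → a * C E * append1 z E)      ∎

  affine-cong : {F G : ProductVector d → ℝ} → (∀ z → F z ≈ G z) → IsAffine F → IsAffine G
  affine-cong F≈G (C , F≈) = C , λ z → trans (sym (F≈G z)) (F≈ z)

  append1-⊥ : (z : ProductVector d) → append1 z ⊥ ≈ 1#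
  append1-⊥ {d = d} z with nonempty? (⊥ {d})
  ... | yes (_ , x∈⊥) = contradiction x∈⊥ ∉⊥
  ... | no  _         = refl

  -- The nonemptiness proof found by `nonempty?` may differ from the one in `originals`; irrelevance
  -- of that field makes the two indices definitionally equal.
  append1-⁅⁆ : (z : ProductVector d) (i : Fin d) → append1 z ⁅ i ⁆ ≈ originals z i
  append1-⁅⁆ z i with nonempty? ⁅ i ⁆
  ... | yes _ = refl
  ... | no ¬p = contradiction (i , x∈⁅x⁆ i) ¬p

  affine-const : ∀ a → IsAffine {d} (λ _ → a)
  affine-const a = affine-cong
    (λ z → trans (*-congˡ (append1-⊥ z)) (*-identityʳ a))
    (affine-* a (affine-coordinate ⊥))

  affine-∑ : {F : Fin n → ProductVector d → ℝ} → (∀ k → IsAffine (F k)) →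
             IsAffine (λ z → ∑ (λ k → F k z))
  affine-∑ {n = zero}  F-affine = affine-const 0#
  affine-∑ {n = suc n} F-affine = affine-+ (F-affine zero) (affine-∑ (F-affine ∘ suc))

  translation-isPolyhedron : (Q : LinearSystem m dx dy) (T : AffineMap dy dx) →
                             IsPolyhedron (T [ Q ])
  translation-isPolyhedron {m} Q T =
    m , (λ j → proj₁ (slack j)) ,
    (λ {z} z∈ j → ≤-respˡ-≈ (proj₂ (slack j) z) (x≤y⇒x-y≤0 (z∈ j))) ,
    (λ {z} z∈ j → x-y≤0⇒x≤y (≤-respˡ-≈ (sym (proj₂ (slack j) z)) (z∈ j)))
    where
    open LinearSystem Q

    -- All terms are moved to the left, as `IsPolyhedron` compares with 0. The row `T k` is itself
    -- the coefficient vector of the expression substituted for the variable `y` of index `k`.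
    slack : ∀ j → IsAffine (λ z → A j ∙ originals z + B j ∙ apply T z - b j)
    slack j = affine-+
      (affine-+
        (affine-∑ λ i → affine-* (A j i)
          (affine-cong (λ z → append1-⁅⁆ z i) (affine-coordinate ⁅ i ⁆)))
        (affine-∑ λ k → affine-* (B j k) (T k , λ z → refl)))
      (affine-const (- b j))

  append1-cong : {z z′ : ProductVector d} → (∀ E → z E ≈ z′ E) →
                 ∀ E → append1 z E ≈ append1 z′ E
  append1-cong z≈z′ E with nonempty? E
  ... | yes E≢∅ = z≈z′ ⟨ E ∣ E≢∅ ⟩
  ... | no  _   = refl

  -- A 0-1 point of the polytope equals some `bits v` only pointwise up to `≈`, so membership of its
  -- product section has to be carried along `≈`.
  translation-cong : (Q : LinearSystem m dx dy) (T : AffineMap dy dx) {z z′ : ProductVector dx} →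
                     (∀ E → z E ≈ z′ E) → z ∈ T [ Q ] → z′ ∈ T [ Q ]
  translation-cong Q T z≈z′ z∈ j = ≤-respˡ-≈
    (+-cong (∙-congˡ (A j) (λ i → z≈z′ _))
            (∙-congˡ (B j) (λ k → ΣSubsets-cong (λ E → *-congˡ (append1-cong z≈z′ E)))))
    (z∈ j)
    where open LinearSystem Q

  -- The product section

  ∏-cong : (E : Subset d) {x y : Vector ℝ d} → (∀ i → x i ≈ y i) → ∏[ E ] x ≈ ∏[ E ] y
  ∏-cong []            x≈y = refl
  ∏-cong (inside  ∷ E) x≈y = *-cong (x≈y zero) (∏-cong E (x≈y ∘ suc))
  ∏-cong (outside ∷ E) x≈y = ∏-cong E (x≈y ∘ suc)

  ∏-⊥ : (x : Vector ℝ d) → ∏[ ⊥ ] x ≈ 1#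
  ∏-⊥ {d = zero}  x = refl
  ∏-⊥ {d = suc d} x = ∏-⊥ (Vector.tail x)

  ∏-⁅⁆ : (i : Fin d) (x : Vector ℝ d) → ∏[ ⁅ i ⁆ ] x ≈ x i
  ∏-⁅⁆ zero    x = trans (*-congˡ (∏-⊥ (Vector.tail x))) (*-identityʳ _)
  ∏-⁅⁆ (suc i) x = ∏-⁅⁆ i (Vector.tail x)

  -- The appended 1 is the empty product, so over a product section `(z,1)` runs through all
  -- multilinear monomials.
  append1-productSection : (x : Vector ℝ d) (E : Subset d) →
                           append1 (productSection x) E ≈ ∏[ E ] x
  append1-productSection x E with nonempty? E
  ... | yes _  = refl
  ... | no E≡∅ = sym (trans (reflexive (≡.cong (λ F → ∏[ F ] x) (Empty-unique E≡∅))) (∏-⊥ x))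

  -- Coefficients of the multilinear polynomial that takes the values `g` on the cube, obtained by
  -- expanding `g` in its first argument `b` as g₀ + b(g₁ - g₀). Unfolded, this is the alternating
  -- sum of `g` over the subsets of `E`.
  möbius : (Vec Bool d → ℝ) → Subset d → ℝ
  möbius g []            = g []
  möbius g (outside ∷ E) = möbius (g ∘ (false ∷_)) E
  möbius g (inside  ∷ E) = möbius (g ∘ (true ∷_)) E - möbius (g ∘ (false ∷_)) E

  -- Subsets without and with the first element are paired. The joint coefficient μ₀ + b(μ₁ - μ₀) is
  -- μ₀ or μ₁ according to `b`, which leaves the inversion for `g` restricted to that first bit.
  möbius-inversion : (g : Vec Bool d → ℝ) (v : Vec Bool d) →
                     ΣSubsets (λ E → möbius g E * ∏[ E ] (bits v)) ≈ g v
  möbius-inversion g []      = *-identityʳ (g [])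
  möbius-inversion {d = suc d} g (b ∷ v) = begin
    ΣSubsets (λ E → μ₀ E * π E) + ΣSubsets (λ E → (μ₁ E - μ₀ E) * (fromBool b * π E))
      ≈⟨ ΣSubsets-+ (λ E → μ₀ E * π E) _ ⟨
    ΣSubsets (λ E → μ₀ E * π E + (μ₁ E - μ₀ E) * (fromBool b * π E))
      ≈⟨ ΣSubsets-cong (select b) ⟩
    ΣSubsets (λ E → möbius (g ∘ (b ∷_)) E * π E)
      ≈⟨ möbius-inversion (g ∘ (b ∷_)) v ⟩
    g (b ∷ v) ∎
    where
    μ₀ μ₁ π : Subset d → ℝ
    μ₀ = möbius (g ∘ (false ∷_))
    μ₁ = möbius (g ∘ (true ∷_))
    π E = ∏[ E ] (bits v)

    select : ∀ b E → μ₀ E * π E + (μ₁ E - μ₀ E) * (fromBool b * π E) ≈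
                     möbius (g ∘ (b ∷_)) E * π E
    select false E = begin
      μ₀ E * π E + (μ₁ E - μ₀ E) * (0# * π E)  ≈⟨ +-congˡ (*-congˡ (zeroˡ (π E))) ⟩
      μ₀ E * π E + (μ₁ E - μ₀ E) * 0#          ≈⟨ +-congˡ (zeroʳ _) ⟩
      μ₀ E * π E + 0#                          ≈⟨ +-identityʳ _ ⟩
      μ₀ E * π E                               ∎
    select true  E = begin
      μ₀ E * π E + (μ₁ E - μ₀ E) * (1# * π E)  ≈⟨ +-congˡ (*-congˡ (*-identityˡ (π E))) ⟩
      μ₀ E * π E + (μ₁ E - μ₀ E) * π E         ≈⟨ distribʳ (π E) (μ₀ E) _ ⟨
      (μ₀ E + (μ₁ E - μ₀ E)) * π E             ≈⟨ *-congʳ (+-assoc (μ₀ E) (μ₁ E) _) ⟨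
      (μ₀ E + μ₁ E - μ₀ E) * π E               ≈⟨ *-congʳ (xyx⁻¹≈y (μ₀ E) (μ₁ E)) ⟩
      μ₁ E * π E                               ∎

  -- Translations

  -- The left-hand side of each inequality is linear in `(z,1)`, so at the combination it is the
  -- weighted sum of its values at the given points, all of them nonpositive.
  polyhedron∋convexCombination :
    {D : Pred (ProductVector d) q} → IsPolyhedron D →
    {w : Vector ℝ n} → (∀ k → 0# ≤ w k) → ∑ w ≈ 1# →
    {zs : Fin n → ProductVector d} → (∀ k → zs k ∈ D) →
    (λ E → ∑ (λ k → w k * zs k E)) ∈ D
  polyhedron∋convexCombination {n = n} (m , C , D⊆ , ⊆D) {w} 0≤w ∑w≈1 {zs} zs∈D =
    ⊆D λ j → ≤-respˡ-≈ (sym (apply-combination j))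
      (∑-nonpos (λ k → nonneg*nonpos (0≤w k) (D⊆ (zs∈D k) j)))
    where
    append1-combination : ∀ E → append1 (λ F → ∑ (λ k → w k * zs k F)) E ≈
                                ∑ (λ k → w k * append1 (zs k) E)
    append1-combination E with nonempty? E
    ... | yes _ = refl
    -- The appended coordinate is preserved precisely because the weights sum to 1.
    ... | no  _ = trans (sym ∑w≈1) (sum-cong-≋ (λ k → sym (*-identityʳ (w k))))

    apply-combination : ∀ j → apply C (λ F → ∑ (λ k → w k * zs k F)) j ≈
                              ∑ (λ k → w k * apply C (zs k) j)
    apply-combination j = begin
      ΣSubsets (λ E → C j E * append1 (λ F → ∑ (λ k → w k * zs k F)) E)
        ≈⟨ ΣSubsets-cong (λ E → *-congˡ (append1-combination E)) ⟩
      ΣSubsets (λ E → C j E * ∑ (λ k → w k * append1 (zs k) E))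
        ≈⟨ ΣSubsets-cong (λ E → *-distribˡ-sum (C j E) (λ k → w k * append1 (zs k) E)) ⟩
      ΣSubsets (λ E → ∑ (λ k → C j E * (w k * append1 (zs k) E)))
        ≈⟨ ΣSubsets-cong (λ E → sum-cong-≋ (λ k → x∙yz≈y∙xz (C j E) (w k) (append1 (zs k) E))) ⟩
      ΣSubsets (λ E → ∑ (λ k → w k * (C j E * append1 (zs k) E)))
        ≈⟨ ΣSubsets-∑ (λ k E → w k * (C j E * append1 (zs k) E)) ⟩
      ∑ (λ k → ΣSubsets (λ E → w k * (C j E * append1 (zs k) E)))
        ≈⟨ sum-cong-≋ (λ k → *-distribˡ-ΣSubsets (w k) (λ E → C j E * append1 (zs k) E)) ⟨
      ∑ (λ k → w k * apply C (zs k) j) ∎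

  hull⊆projₓ : {D : Pred (ProductVector d) q} → IsPolyhedron D → (S : List (Vec Bool d)) →
               (∀ {v} → v ∈ˡ S → productSection (bits v) ∈ D) → ConvexHull S ⊆ projₓ D
  hull⊆projₓ D-poly S vertices∈D (w , 0≤w , ∑w≈1 , x≈∑) =
    -- The point over `x` is the combination of the product sections of the vertices with the
    -- weights of `x`; its singleton coordinates combine the vertices themselves.
    _ ,
    polyhedron∋convexCombination D-poly 0≤w ∑w≈1 (λ k → vertices∈D (∈-lookup {xs = S} k)) ,
    λ i → trans (sum-cong-≋ (λ k → *-congˡ (∏-⁅⁆ i (bits (lookup S k))))) (sym (x≈∑ i))

  -- Interpolating substitutions

  interpolation : (Vec Bool dx → Vector ℝ dy) → AffineMap dy dx
  interpolation g k = möbius (λ v → g v k)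

  apply-interpolation : (g : Vec Bool dx → Vector ℝ dy) (v : Vec Bool dx) →
                        ∀ k → apply (interpolation g) (productSection (bits v)) k ≈ g v k
  apply-interpolation g v k = trans
    (ΣSubsets-cong (λ E → *-congˡ (append1-productSection (bits v) E)))
    (möbius-inversion (λ u → g u k) v)

  -- At the product section of `v` the substituted expressions evaluate to `g v` and the singleton
  -- coordinates to the bits of `v`, so the translated system becomes `Q` at `(bits v , g v)`.
  section∈interpolation : (Q : LinearSystem m dx dy) (g : Vec Bool dx → Vector ℝ dy) →
                          ∀ v → (bits v , g v) ∈ ⟦ Q ⟧ →
                          productSection (bits v) ∈ interpolation g [ Q ]
  section∈interpolation Q g v v∈Q j = ≤-respˡ-≈
    (+-cong (∙-congˡ (A j) (λ i → sym (∏-⁅⁆ i (bits v))))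
            (∙-congˡ (B j) (λ k → sym (apply-interpolation g v k))))
    (v∈Q j)
    where open LinearSystem Q

  projₓ-translation⊆proj : (Q : LinearSystem m dx dy) (T : AffineMap dy dx) →
                           projₓ (T [ Q ]) ⊆ proj ⟦ Q ⟧
  projₓ-translation⊆proj Q T (z , z∈ , z≈x) =
    apply T z , λ j → ≤-respˡ-≈ (+-congʳ (∙-congˡ (A j) z≈x)) (z∈ j)
    where open LinearSystem Q

  module _ {K : Pred (Vector ℝ dx × Vector ℝ dy) q} (S : List (Vec Bool dx))
           (lifts : ∀ {v} → v ∈ˡ S → bits v ∈ proj K) where

    -- Interpolation needs a lift that is a function of `v`, whereas `lifts` may vary with the
    -- membership proof. Taking the proof from the decision `v ∈? S` fixes one choice.
    liftVertex : Vec Bool dx → Vector ℝ dy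
    liftVertex v with v ∈? S
    ... | yes v∈S = proj₁ (lifts v∈S)
    -- Vectors outside `S` impose no condition, so any value serves here.
    ... | no  _   = λ _ → 0#

    liftVertex∈ : ∀ {v} → v ∈ˡ S → (bits v , liftVertex v) ∈ K
    liftVertex∈ {v} v∈S with v ∈? S
    ... | yes v∈S′ = proj₂ (lifts v∈S′)
    ... | no  v∉S  = contradiction v∈S v∉S

theorem3p1 : ∀ {c ℓ₁ ℓ₂ p} (𝓡 : RealField c ℓ₁ ℓ₂) → let open ZeroOnePolytopes 𝓡 in
    ∀ {dx : ℕ} (P : Pred (Vector ℝ dx) p) → IsZeroOnePolytope P →
    ∀ {dy m : ℕ} (Q : LinearSystem m dx dy) → Bounded ⟦ Q ⟧ →
    P ⊆ proj ⟦ Q ⟧ →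
    Σ[ T ∈ AffineMap dy dx ]
    (IsTranslation P Q T × P ⊆ projₓ (T [ Q ]) × projₓ (T [ Q ]) ⊆ proj ⟦ Q ⟧)
theorem3p1 𝓡 {dx} P (S , P⊆hull , hull⊆P) {dy} Q _ P⊆Q =
  T , record
    { isPolyhedron    = T[Q]-poly
    ; isRelaxation    = P⊆T[Q]
    ; containsSection = containsSection
    } , P⊆T[Q] , projₓ-translation⊆proj 𝓡 Q T
  where
  open ZeroOnePolytopes 𝓡 hiding (zero)

  lifts : ∀ {v} → v ∈ˡ S → bits 𝓡 v ∈ proj ⟦ Q ⟧
  lifts v∈S = P⊆Q (hull⊆P (vertex∈hull 𝓡 v∈S))

  g : Vec Bool dx → Vector ℝ dy
  g = liftVertex 𝓡 {K = ⟦ Q ⟧} S lifts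

  T : AffineMap dy dx
  T = interpolation 𝓡 g

  T[Q]-poly : IsPolyhedron (T [ Q ])
  T[Q]-poly = translation-isPolyhedron 𝓡 Q T

  vertexSection∈ : ∀ {v} → v ∈ˡ S → productSection (bits 𝓡 v) ∈ T [ Q ]
  vertexSection∈ {v} v∈S =
    section∈interpolation 𝓡 Q g v (liftVertex∈ 𝓡 {K = ⟦ Q ⟧} S lifts v∈S)

  P⊆T[Q] : P ⊆ projₓ (T [ Q ])
  P⊆T[Q] x∈P = hull⊆projₓ 𝓡 T[Q]-poly S vertexSection∈ (P⊆hull x∈P)

  containsSection : ∀ x → x ∈ P → ZeroOne x → productSection x ∈ T [ Q ]
  -- A 0-1 point of the hull must be listed in `S`, and for listed vectors the section was placed in
  -- the translation by interpolation.
  containsSection x x∈P x∈01 with ZeroOne⇒bits 𝓡 x∈01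
  ... | v , x≈v = translation-cong 𝓡 Q T
    (λ { ⟨ E ∣ _ ⟩ → ∏-cong 𝓡 E (sym ∘ x≈v) })
    (vertexSection∈ (hull∩bits⇒∈ 𝓡 S v (ConvexHull-cong 𝓡 S x≈v (P⊆hull x∈P))))
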